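{- Let $n \in \mathbb{N}$ and $k \in \mathbb{N}\setminus\{0\}$. Then $F(GT(n,k)) = \max(Ap(GT(n,k),s_0)) - s_0$, and the maximal element $M=\max(Ap(GT(n,k),s_0))$ and the Frobenius number $F=F(GT(n,k))$ are given as follows. 1. If $n=0$: $M=s_1$ and $F=s_1-2$. 2. If $n\neq 0$ and $k=1$: $M=s_n+s_{n+1}$ and $F=s_n+s_{n+1}-s_0$. 3. If $2\le k<n$: $M=t_1s_1+\cdots+t_{n-2}s_{n-2}+s_{n-1}+s_{n+k}$ and $F=t_1s_1+\cdots+t_{n-2}s_{n-2}+s_{n-1}+s_{n+k}-s_0$, where $t_1,\dots,t_{n-2}$ are such that $(t_1,\dots,t_{n-2},1,0,\dots,0,1)\in A(n,\delta)$ (with entry $1$ in positions $n-1$ and $n+k$, and $0$ in positions $n,\dots,n+k-1$) and $\sum_{i=1}^{n-2}(2^i-1)t_i=2^{n-1}-2^k+2$. 4. If $n=k\ge 1$: $M=s_1+s_{2n}$ and $F=s_1+s_{2n}-s_0$. 5. If $n\neq 0$, $k>n$ and $k\neq 2$: $M=t_1s_1+\cdots+t_{k-1}s_{k-1}+s_k+s_{k+1}+\cdots+s_{n+k-1}$ and $F=t_1s_1+\cdots+t_{k-1}s_{k-1}+s_k+\cdots+s_{n+k-1}-s_0$, where $t_1,\dots,t_{k-1}$ are such that $(t_1,\dots,t_{k-1},1,\dots,1)\in A(n,\delta)$ (with entry $1$ in positions $k,\dots,n+k-1$) and $\sum_{i=1}^{k-1}(2^i-1)t_i=2^n+n$. 6.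 If $n=1$ and $k=2$: $M=74$ and $F=67$.
   Context: $\mathbb{N}$ is the set of nonnegative integers. $s_i=(2^k+1)\cdot 2^{n+i}-(2^k-1)$ for $i\in\mathbb{N}$, and $GT(n,k)=\langle\{s_i : i\in\mathbb{N}\}\rangle$ is the submonoid of $(\mathbb{N},+)$ generated by the $s_i$ (the generalized Thabit numerical semigroup). For a numerical semigroup $S$ (a submonoid of $(\mathbb N,+)$ with finite complement), $F(S)$ is the greatest integer not belonging to $S$ (Frobenius number), and for $x\in S\setminus\{0\}$ the Apéry set is $Ap(S,x)=\{s\in S : s-x\notin S\}$. Put $\delta=1$ if $n=0$; $\delta=k$ if $n\neq0$ and $k\le n$; $\delta=k-1$ if $n\neq 0$ and $k>n$. $A(n,\delta)$ is the set of sequences $(t_1,\dots,t_{n+\delta})\in\{0,1,2\}^{n+\delta}$ such that $t_{n+\delta}\in\{0,1\}$ and, for every $j$, if $t_j=2$ then $t_i=0$ for all $i<j$. -}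

module Defs where

open import Level using (Level; 0ℓ; _⊔_)
open import Data.Bool.Base using (if_then_else_)
open import Data.Fin.Base as Fin using (Fin; toℕ)
open import Data.Integer.Base as ℤ using (ℤ)
open import Data.List.Base using (List; []; _∷_; _++_; length; lookup; replicate)
open import Data.Nat.Base using (ℕ; zero; suc; _+_; _*_; _∸_; _^_)
open import Data.Nat.Properties using (_≤?_; +-0-monoid)
open import Data.Product.Base using (∃; _×_)
open import Data.Sum.Base using (_⊎_)
open import Data.Vec.Functional using (Vector; toList)
open import Relation.Binary.Core using (Rel)
open import Relation.Binary.PropositionalEquality.Core using (_≡_)
open import Relation.Nullary using (¬_; does)
open import Relation.Unary using (Pred; _∈_; _∉_)

open import Algebra.Properties.Monoid.Sum +-0-monoid public
  using (sum-syntax)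

private
  variable
    a p ℓ : Level

Greatest : {A : Set a} → Rel A ℓ → Pred A p → Pred A (a ⊔ p ⊔ ℓ)
Greatest _≤_ P m = m ∈ P × (∀ {x} → x ∈ P → x ≤ m)

data ⟨_⟩ (X : Pred ℕ 0ℓ) : Pred ℕ 0ℓ where
  gen : ∀ {x} → x ∈ X → x ∈ ⟨ X ⟩
  0∈  : 0 ∈ ⟨ X ⟩
  +∈  : ∀ {x y} → x ∈ ⟨ X ⟩ → y ∈ ⟨ X ⟩ → x + y ∈ ⟨ X ⟩

-- A set of naturals viewed as a set of integers: negative integers are
-- never members.
embed : Pred ℕ 0ℓ → Pred ℤ 0ℓ
embed S z = ∃ λ m → z ≡ ℤ.+ m × m ∈ S

IsFrobeniusNumber : Pred ℕ 0ℓ → Pred ℤ 0ℓ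
IsFrobeniusNumber S = Greatest ℤ._≤_ (λ z → z ∉ embed S)

-- The difference is taken in ℤ; with truncated subtraction every s < x
-- would be excluded, since 0 ∈ S.
Ap : Pred ℕ 0ℓ → ℕ → Pred ℕ 0ℓ
Ap S x s = s ∈ S × (ℤ.+ s ℤ.- ℤ.+ x) ∉ embed S

-- Neither subtraction truncates: 2 ^ k ≥ 1, and the first term exceeds 2 ^ k.
s : ℕ → ℕ → ℕ → ℕ
s n k i = (2 ^ k + 1) * 2 ^ (n + i) ∸ (2 ^ k ∸ 1)

GT : ℕ → ℕ → Pred ℕ 0ℓ
GT n k = ⟨ (λ x → ∃ λ i → x ≡ s n k i) ⟩

δ : ℕ → ℕ → ℕ
δ zero      k = 1
δ n@(suc _) k = if does (k ≤? n) then k else k ∸ 1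

pattern 0₃ = Fin.zero
pattern 1₃ = Fin.suc Fin.zero
pattern 2₃ = Fin.suc (Fin.suc Fin.zero)

-- Lists of prescribed length rather than vectors, so that sequences built by
-- concatenation need no transport along an equation between lengths.
-- The entry tⱼ is found at the (0-based) position j - 1.
A : ℕ → ℕ → Pred (List (Fin 3)) 0ℓ
A n d t
  = length t ≡ n + d
  × (∀ j → suc (toℕ j) ≡ n + d → lookup t j ≡ 0₃ ⊎ lookup t j ≡ 1₃)
  × (∀ j → lookup t j ≡ 2₃ → ∀ i → i Fin.< j → lookup t i ≡ 0₃)

-- ∑ᵢ tᵢ f(i) for i = 1, …, m, where tᵢ is t at the 0-based index i - 1.
weightedSum : ∀ {m} → Vector (Fin 3) m → (ℕ → ℕ) → ℕ
weightedSum {m} t f = ∑[ i < m ] (toℕ (t i) * f (suc (toℕ i)))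

-- The conditions on (t₁, …, t₍ₙ₋₂₎), for 2 ≤ k < n, and on (t₁, …, t₍ₖ₋₁₎), for
-- k > n ≥ 1.  In these ranges no subtraction truncates.
Coeffs-k<n : (n k : ℕ) → Pred (Vector (Fin 3) (n ∸ 2)) 0ℓ
Coeffs-k<n n k t
  = toList t ++ 1₃ ∷ replicate k 0₃ ++ 1₃ ∷ [] ∈ A n (δ n k)
  × weightedSum t (λ i → 2 ^ i ∸ 1) ≡ (2 ^ (n ∸ 1) ∸ 2 ^ k) + 2

Coeffs-k>n : (n k : ℕ) → Pred (Vector (Fin 3) (k ∸ 1)) 0ℓ
Coeffs-k>n n k t
  = toList t ++ replicate n 1₃ ∈ A n (δ n k)
  × weightedSum t (λ i → 2 ^ i ∸ 1) ≡ 2 ^ n + n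

{-# OPTIONS --safe #-}

-- Write s₀ = c and 2ᵏ - 1 = p, so that sᵢ = c 2ⁱ + p (2ⁱ - 1).  Thus GT(n,k)
-- consists of the numbers c W + p j with W a sum of W - j powers of 2, and such W
-- exists with a given j exactly when j is at most W minus the binary digit sum of
-- W, i.e. the 2-adic valuation v(W) of W!.  As c and p are coprime and v is
-- monotone, the largest element of the Apéry set is c W + p (c - 1), for the
-- least W with v(W) ≥ c - 1.  If c - 1 = Σ tᵢ (2ⁱ - 1) is a skew binary expansion
-- (digit 2 only at the first nonzero place), then this W is Σ tᵢ 2ⁱ, and the
-- maximum is Σ tᵢ sᵢ.  Each case of the theorem is one such expansion.

module Submission where

open import Defs
open import Data.Fin.Base as Fin using (Fin; toℕ)
import Data.Fin.Properties as Fin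
open import Data.Integer.Base as ℤ using (ℤ; +_; -[1+_]; _-_; +≤+)
import Data.Integer.Properties as ℤ
open import Data.List.Base using (List; []; _∷_; [_]; _++_; length; lookup; replicate)
open import Data.List.Properties using (length-++; length-replicate; length-tabulate; tabulate-lookup)
open import Data.List.Membership.Propositional.Properties using (∈-lookup)
open import Data.List.Relation.Unary.All as All using (All; []; _∷_)
import Data.List.Relation.Unary.All.Properties as All
open import Data.Nat.Base
  using (ℕ; zero; suc; pred; _+_; _∸_; _*_; _^_; _≤_; _<_; _>_; z≤n; s≤s; ⌊_/2⌋;
         NonZero; >-nonZero; >-nonZero⁻¹)
open import Data.Nat.Coprimality using (Coprime; coprime-Bézout; coprime-divisor)
open import Data.Nat.Divisibility using (_∣_; ∣-trans; ∣⇒≤; ∣m∣n⇒∣m+n; ∣m+n∣m⇒∣n; m∣m*n; ∣1⇒≡1)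
open import Data.Nat.DivMod using (_/_; _%_; m≡m%n+[m/n]*n; m%n<n)
open import Data.Nat.GCD using (module Bézout)
open import Data.Nat.Properties
open import Algebra.Properties.Monoid.Sum +-0-monoid using (sum-cong-≗)
open import Data.Nat.Tactic.RingSolver using (solve-∀)
open import Data.Product.Base using (∃; ∃₂; _×_; _,_; proj₁; proj₂)
open import Data.Sum.Base using (_⊎_; inj₁; inj₂)
open import Data.Vec.Functional using (Vector; toList)
open import Function.Base using (_∘_)
open import Level using (0ℓ)
open import Relation.Binary.PropositionalEquality
  using (_≡_; _≢_; _≗_; refl; sym; trans; cong; cong₂; subst; module ≡-Reasoning)
open import Relation.Nullary using (yes; no; contradiction)
open import Relation.Nullary.Decidable using (dec-true; dec-false)
open import Relation.Unary using (Pred; _∈_; _∉_)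

-- Differences of naturals taken in ℤ.

[m+n]-n≡m : ∀ m n → + (m + n) - + n ≡ + m
[m+n]-n≡m m n = trans (ℤ.+-assoc (+ m) (+ n) (ℤ.- + n))
  (trans (cong (λ i → + m ℤ.+ i) (ℤ.+-inverseʳ (+ n))) (ℤ.+-identityʳ (+ m)))

m-n≡o⇒m≡o+n : ∀ {m n o} → + m - + n ≡ + o → m ≡ o + n
m-n≡o⇒m≡o+n {m} {n} {o} eq = ℤ.+-injective (begin
  + m                        ≡⟨ ℤ.+-identityʳ (+ m) ⟨
  + m ℤ.+ + 0                ≡⟨ cong (λ i → + m ℤ.+ i) (ℤ.+-inverseˡ (+ n)) ⟨
  + m ℤ.+ (ℤ.- + n ℤ.+ + n)  ≡⟨ ℤ.+-assoc (+ m) (ℤ.- + n) (+ n) ⟨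
  (+ m - + n) ℤ.+ + n        ≡⟨ cong (ℤ._+ + n) eq ⟩
  + o ℤ.+ + n                ∎)
  where open ≡-Reasoning

m+n≤o⇒m≤o-n : ∀ m n {o} → m + n ≤ o → + m ℤ.≤ + o - + n
m+n≤o⇒m≤o-n m n m+n≤o = subst (ℤ._≤ _) ([m+n]-n≡m m n) (ℤ.+-monoˡ-≤ (ℤ.- + n) (+≤+ m+n≤o))

-- Serves to place the negative integers, none of which are members, below the Frobenius number.
n≤1+m⇒-1≤m-n : ∀ {m n} → n ≤ suc m → -[1+ 0 ] ℤ.≤ + m - + n
n≤1+m⇒-1≤m-n {m} {n} n≤1+m = subst (-[1+ 0 ] ℤ.≤_) eq (ℤ.+-monoʳ-≤ -[1+ 0 ] (m+n≤o⇒m≤o-n 0 n n≤1+m))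
  where
  eq : -[1+ 0 ] ℤ.+ (+ suc m - + n) ≡ + m - + n
  eq = sym (ℤ.+-assoc -[1+ 0 ] (+ suc m) (ℤ.- + n))

-- Sums of powers of 2.

-- Rep W j: W is a sum of W ∸ j powers of 2.
data Rep : ℕ → ℕ → Set where
  empty : Rep 0 0
  power : ∀ i → Rep (2 ^ i) (2 ^ i ∸ 1)
  _⊕_   : ∀ {W j W′ j′} → Rep W j → Rep W′ j′ → Rep (W + W′) (j + j′)

-- Each added summand is `2 ^ 0`, whose contribution `2 ^ 0 ∸ 1` to `j` is 0.
Rep-raise : ∀ d {W j} → Rep W j → Rep (d + W) j
Rep-raise zero    r = r
Rep-raise (suc d) r = power 0 ⊕ Rep-raise d r

suc[2^n∸1]≡2^n : ∀ n → suc (2 ^ n ∸ 1) ≡ 2 ^ n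
suc[2^n∸1]≡2^n n = m+[n∸m]≡n (m^n>0 2 n)

-- A power 2 ^ (1 + i) may be split into two halves, which uses one more power.
Rep-pred : ∀ {W j j′} → Rep W j → j ≡ suc j′ → Rep W j′
Rep-pred {j′ = j′} (power (suc i)) eq = subst (λ w → Rep w j′) (cong (λ w → 2 ^ i + w) (sym (+-identityʳ (2 ^ i))))
  (subst (Rep _) (suc-injective (trans lem eq)) (power i ⊕ power i))
  where
  lem : suc ((2 ^ i ∸ 1) + (2 ^ i ∸ 1)) ≡ 2 ^ suc i ∸ 1
  lem = suc-injective (trans (trans (cong suc (sym (+-suc _ _)))
    (cong₂ _+_ (suc[2^n∸1]≡2^n i) (trans (suc[2^n∸1]≡2^n i) (sym (+-identityʳ _))))) (sym (suc[2^n∸1]≡2^n (suc i))))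
Rep-pred (_⊕_ {j = suc j} r r′) refl = Rep-pred r refl ⊕ r′
Rep-pred (_⊕_ {j = zero}  r r′) eq   = r ⊕ Rep-pred r′ eq

Rep-lower : ∀ {W j} d → Rep W (d + j) → Rep W j
Rep-lower zero    r = r
Rep-lower (suc d) r = Rep-lower d (Rep-pred r refl)

-- Legendre's formula as a bound on `j`.

-- For f large this is the exponent of 2 in W ! (Legendre’s formula).
legendre : ℕ → ℕ → ℕ
legendre zero    W = 0
legendre (suc f) W = ⌊ W /2⌋ + legendre f ⌊ W /2⌋

legendre-mono : ∀ {f g W W′} → f ≤ g → W ≤ W′ → legendre f W ≤ legendre g W′
legendre-mono z≤n       W≤W′ = z≤n
legendre-mono (s≤s f≤g) W≤W′ = +-mono-≤ (⌊n/2⌋-mono W≤W′) (legendre-mono f≤g (⌊n/2⌋-mono W≤W′))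

⌊/2⌋-superadditive : ∀ m n → ⌊ m /2⌋ + ⌊ n /2⌋ ≤ ⌊ m + n /2⌋
⌊/2⌋-superadditive zero          n = ≤-refl
⌊/2⌋-superadditive (suc zero)    n = ⌊n/2⌋-mono (n≤1+n n)
⌊/2⌋-superadditive (suc (suc m)) n = s≤s (⌊/2⌋-superadditive m n)

+-interchange : ∀ a b c d → (a + b) + (c + d) ≡ (a + c) + (b + d)
+-interchange = solve-∀

-- Mirrors the divisibility of (W + W′)! by W! W′!. Halving is superadditive, and monotonicity
-- passes the excess on to the remaining halvings.
legendre-superadditive : ∀ f W W′ → legendre f W + legendre f W′ ≤ legendre f (W + W′)
legendre-superadditive zero    W W′ = z≤n
legendre-superadditive (suc f) W W′ = begin
  (⌊ W /2⌋ + legendre f ⌊ W /2⌋) + (⌊ W′ /2⌋ + legendre f ⌊ W′ /2⌋)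
    ≡⟨ +-interchange ⌊ W /2⌋ _ ⌊ W′ /2⌋ _ ⟩
  (⌊ W /2⌋ + ⌊ W′ /2⌋) + (legendre f ⌊ W /2⌋ + legendre f ⌊ W′ /2⌋)
    ≤⟨ +-monoʳ-≤ (⌊ W /2⌋ + ⌊ W′ /2⌋) (legendre-superadditive f ⌊ W /2⌋ ⌊ W′ /2⌋) ⟩
  (⌊ W /2⌋ + ⌊ W′ /2⌋) + legendre f (⌊ W /2⌋ + ⌊ W′ /2⌋)
    ≤⟨ +-mono-≤ h≤ (legendre-mono {f} ≤-refl h≤) ⟩
  ⌊ W + W′ /2⌋ + legendre f ⌊ W + W′ /2⌋
    ∎
  where
  open ≤-Reasoning
  h≤ = ⌊/2⌋-superadditive W W′

⌊2*n/2⌋≡n : ∀ n → ⌊ 2 * n /2⌋ ≡ n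
⌊2*n/2⌋≡n n = trans (cong (λ m → ⌊ n + m /2⌋) (+-identityʳ n)) (sym (n≡⌊n+n/2⌋ n))

⌊1+2*n/2⌋≡n : ∀ n → ⌊ suc (2 * n) /2⌋ ≡ n
⌊1+2*n/2⌋≡n zero    = refl
⌊1+2*n/2⌋≡n (suc n) = trans (cong (λ m → ⌊ suc m /2⌋) (lem n)) (cong suc (⌊1+2*n/2⌋≡n n))
  where
  lem : ∀ n → 2 * suc n ≡ suc (suc (2 * n))
  lem = solve-∀

-- The successive halves 2ⁿ⁻¹, ..., 2, 1 add up to 2ⁿ - 1, so `n` halvings reach the full value.
2^n≤1+legendre : ∀ n → 2 ^ n ≤ suc (legendre n (2 ^ n))
2^n≤1+legendre zero    = ≤-refl
2^n≤1+legendre (suc n) rewrite ⌊2*n/2⌋≡n (2 ^ n) | +-identityʳ (2 ^ n) =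
  ≤-trans (+-monoʳ-≤ (2 ^ n) (2^n≤1+legendre n)) (≤-reflexive (+-suc _ _))

-- A single power attains its bound, and superadditivity handles sums. The number of halvings is
-- existential because the two summands may require different ones; `f + g` serves both.
Rep⇒≤legendre : ∀ {W j} → Rep W j → ∃ λ f → j ≤ legendre f W
Rep⇒≤legendre empty     = 0 , z≤n
Rep⇒≤legendre (power i) = i , ∸-monoˡ-≤ 1 (2^n≤1+legendre i)
Rep⇒≤legendre (_⊕_ {W} {j} {W′} {j′} r r′) with Rep⇒≤legendre r | Rep⇒≤legendre r′
... | f , j≤ | g , j′≤ = f + g , ≤-trans
  (+-mono-≤ (≤-trans j≤ (legendre-mono (m≤m+n f g) ≤-refl)) (≤-trans j′≤ (legendre-mono (m≤n+m g f) ≤-refl)))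
  (legendre-superadditive (f + g) W W′)

-- Apéry set and Frobenius number of a semigroup of numbers c W + p j.

-- Modulo c an element c W + p j depends only on j, and its Apéry representative
-- has j < c and W least possible; hence the maximum is reached at j = c - 1.
module _ {S : Pred ℕ 0ℓ} {c p : ℕ} .{{_ : NonZero c}} .{{_ : NonZero p}}
  (Rep⇒∈ : ∀ {W j} → Rep W j → c * W + p * j ∈ S)
  (∈⇒Rep : ∀ {x} → x ∈ S → ∃₂ λ W j → Rep W j × x ≡ c * W + p * j)
  (coprime : Coprime c p)
  {W J : ℕ} (c≡1+J : c ≡ suc J) (rep : Rep W J)
  (minimal : ∀ {W′ j} → Rep W′ j → J ≤ j → W ≤ W′)
  where

  private
    M = c * W + p * J

  -- If `J ≤ j`, minimality of `W` gives `y ≥ M`. If `j < J`, reduction modulo `c` makes `c` divide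
  -- `p * (J ∸ j)`, hence `J ∸ j`, although 0 < J - j < c.
  M-c∉ : ∀ {y} → y ∈ S → y + c ≢ M
  M-c∉ y∈S y+c≡M with ∈⇒Rep y∈S
  ... | W′ , j , r , refl with J ≤? j
  ...   | yes J≤j = <-irrefl (sym y+c≡M) (begin-strict
    M                   ≤⟨ +-mono-≤ (*-monoʳ-≤ c (minimal r J≤j)) (*-monoʳ-≤ p J≤j) ⟩
    c * W′ + p * j      <⟨ m<m+n _ (>-nonZero⁻¹ c) ⟩
    c * W′ + p * j + c  ∎)
    where open ≤-Reasoning
  ...   | no J≰j with m≤n⇒∃[o]m+o≡n (≰⇒> J≰j)
  ...     | d , refl = <⇒≱ 1+d<c (∣⇒≤ c∣1+d)
    where
    1+d<c : suc d < c
    1+d<c = subst (suc d <_) (sym c≡1+J) (s≤s (s≤s (m≤n+m d j)))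
    lhs : ∀ c p j d W′ → c * suc W′ + p * j ≡ c * W′ + p * j + c
    lhs = solve-∀
    rhs : ∀ c p j d W → c * W + p * (suc j + d) ≡ (c * W + p * suc d) + p * j
    rhs = solve-∀
    c∣1+d : c ∣ suc d
    c∣1+d = coprime-divisor coprime (∣m+n∣m⇒∣n
      (subst (c ∣_) (+-cancelʳ-≡ (p * j) _ _ (trans (lhs c p j d W′) (trans y+c≡M (rhs c p j d W)))) (m∣m*n (suc W′)))
      (m∣m*n W))

  -- An element c W′ + p j with `j > J` or `W′ > W` stays in `S` when `c` is subtracted, so in the
  -- Apéry set both parameters are bounded.
  M-upper : ∀ {x} → x ∈ S → (∀ {y} → y ∈ S → y + c ≢ x) → x ≤ M
  M-upper x∈S x-c∉ with ∈⇒Rep x∈S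
  ... | W′ , j , r , refl with j ≤? J
  ...   | no j≰J with m≤n⇒∃[o]m+o≡n (subst (_≤ j) (sym c≡1+J) (≰⇒> j≰J))
  -- With j = c + d, the multiple p c is moved to the other term, which raises W′ by `p`;
  -- subtracting `c` leaves a raise by `pred p`.
  ...     | d , refl = contradiction (lem (pred p) (suc-pred p)) (x-c∉ (Rep⇒∈ (Rep-raise (pred p) (Rep-lower c r))))
    where
    lem′ : ∀ c d W q → c * (q + W) + suc q * d + c ≡ c * W + suc q * (c + d)
    lem′ = solve-∀
    lem : ∀ q → suc q ≡ p → c * (q + W′) + p * d + c ≡ c * W′ + p * (c + d)
    lem q refl = lem′ c d W′ q
  M-upper x∈S x-c∉ | W′ , j , r , refl | yes j≤J with W′ ≤? W
  ...     | yes W′≤W = +-mono-≤ (*-monoʳ-≤ c W′≤W) (*-monoʳ-≤ p j≤J)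
  ...     | no  W′≰W with m≤n⇒∃[o]m+o≡n (≰⇒> W′≰W)
  -- Here W′ - 1 = W + d, and `rep` can be lowered from `J` to `j` and raised by `d`, so x - c is
  -- represented.
  ...       | d , refl = contradiction (lem c d W (p * j))
    (x-c∉ (Rep⇒∈ (Rep-raise d (Rep-lower (J ∸ j) (subst (Rep W) (sym (m∸n+n≡m j≤J)) rep)))))
    where
    lem : ∀ c d W m → c * (d + W) + m + c ≡ c * (suc W + d) + m
    lem = solve-∀

  -- `x` is an inverse of `p` modulo `c`; multiples of `c` on both sides keep the congruence within
  -- ℕ.
  inverse : ∃ λ x → ∃₂ λ a b → 1 + c * a ≡ p * x + c * b
  inverse with coprime-Bézout coprime
  ... | Bézout.-+ x y eq = y , x , 0 , trans (cong suc (*-comm c x)) (trans eq (lem c p y))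
    where
    lem : ∀ c p y → y * p ≡ p * y + c * 0
    lem = solve-∀
  -- Now `y` is an inverse of -p, and `J` is congruent to -1, so `y * J` is an inverse of `p`.
  ... | Bézout.+- x y eq = y * J , x * J , 1 , (begin
    1 + c * (x * J)          ≡⟨ lem₁ c x J ⟩
    1 + x * c * J            ≡⟨ cong (λ m → 1 + m * J) eq ⟨
    1 + (1 + y * p) * J      ≡⟨ lem₂ p y J ⟩
    p * (y * J) + suc J * 1  ≡⟨ cong (λ m → p * (y * J) + m * 1) c≡1+J ⟨
    p * (y * J) + c * 1      ∎)
    where
    open ≡-Reasoning
    lem₁ : ∀ c x J → 1 + c * (x * J) ≡ 1 + x * c * J
    lem₁ = solve-∀
    lem₂ : ∀ p y J → 1 + (1 + y * p) * J ≡ p * (y * J) + suc J * 1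
    lem₂ = solve-∀

  residue : ∀ z → ∃₂ λ j a → ∃ λ b → j ≤ J × z + c * a ≡ p * j + c * b
  residue z with inverse
  ... | x , a , b , eq = (x * z) % c , a * z , p * ((x * z) / c) + b * z ,
    m<1+n⇒m≤n (subst ((x * z) % c <_) c≡1+J (m%n<n (x * z) c)) , (begin
    z + c * (a * z)                              ≡⟨ lem₁ z c a ⟩
    (1 + c * a) * z                              ≡⟨ cong (_* z) eq ⟩
    (p * x + c * b) * z                          ≡⟨ lem₂ z p c x b ⟩
    p * (x * z) + c * (b * z)                    ≡⟨ cong (λ m → p * m + c * (b * z)) (m≡m%n+[m/n]*n (x * z) c) ⟩
    p * (r + q * c) + c * (b * z)                ≡⟨ lem₃ p c r q (b * z) ⟩
    p * r + c * (p * q + b * z)                  ∎)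
    where
    open ≡-Reasoning
    r = (x * z) % c
    q = (x * z) / c
    lem₁ : ∀ z c a → z + c * (a * z) ≡ (1 + c * a) * z
    lem₁ = solve-∀
    lem₂ : ∀ z p c x b → (p * x + c * b) * z ≡ p * (x * z) + c * (b * z)
    lem₂ = solve-∀
    lem₃ : ∀ p c r q m → p * (r + q * c) + c * m ≡ p * r + c * (p * q + m)
    lem₃ = solve-∀

  -- By `residue`, z = p j + c (b - a) with `j ≤ J`. Since z + c > c W + p J, the coefficient b - a
  -- is at least `W`; so `rep`, lowered to `j` and raised, represents `z`.
  >M-c⇒∈ : ∀ {z} → M < z + c → z ∈ S
  >M-c⇒∈ {z} M<z+c =
    let j , a , b , j≤J , eq = residue z
        d , W+a+d≡b = m≤n⇒∃[o]m+o≡n (W+a≤b a b j≤J eq)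
        z≡ = +-cancelʳ-≡ (c * a) _ _ (trans eq (trans (cong (λ m → p * j + c * m) (sym W+a+d≡b)) (lem₄ (p * j) c W a d)))
    in subst (_∈ S) (sym z≡) (Rep⇒∈ (Rep-raise d (Rep-lower (J ∸ j) (subst (Rep W) (sym (m∸n+n≡m j≤J)) rep))))
    where
    open ≤-Reasoning
    lem₁ : ∀ c W a m → c * (W + a) + m ≡ c * W + m + c * a
    lem₁ = solve-∀
    lem₂ : ∀ z c a → z + c + c * a ≡ (z + c * a) + c
    lem₂ = solve-∀
    lem₃ : ∀ m c b → m + c * b + c ≡ c * suc b + m
    lem₃ = solve-∀
    lem₄ : ∀ m c W a d → m + c * (W + a + d) ≡ (c * (d + W) + m) + c * a
    lem₄ = solve-∀
    W+a≤b : ∀ {j} a b → j ≤ J → z + c * a ≡ p * j + c * b → W + a ≤ b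
    W+a≤b {j} a b j≤J eq = m<1+n⇒m≤n (*-cancelˡ-< c (W + a) (suc b) (+-cancelʳ-< (p * J) _ _ (begin-strict
      c * (W + a) + p * J  ≡⟨ lem₁ c W a (p * J) ⟩
      M + c * a            <⟨ +-monoˡ-< (c * a) M<z+c ⟩
      z + c + c * a        ≡⟨ lem₂ z c a ⟩
      (z + c * a) + c      ≡⟨ cong (_+ c) eq ⟩
      p * j + c * b + c    ≡⟨ lem₃ (p * j) c b ⟩
      c * suc b + p * j    ≤⟨ +-monoʳ-≤ (c * suc b) (*-monoʳ-≤ p j≤J) ⟩
      c * suc b + p * J    ∎)))

  Ap-greatest : Greatest _≤_ (Ap S c) M
  Ap-greatest = (Rep⇒∈ rep , λ (m , eq , m∈S) → M-c∉ m∈S (sym (m-n≡o⇒m≡o+n eq)))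
    , λ (x∈S , x-c∉) → M-upper x∈S (λ {y} y∈S y+c≡x →
        x-c∉ (y , trans (cong (λ m → + m - + c) (sym y+c≡x)) ([m+n]-n≡m y c) , y∈S))

  frobenius : IsFrobeniusNumber S (+ M - + c)
  frobenius = (λ (m , eq , m∈S) → M-c∉ m∈S (sym (m-n≡o⇒m≡o+n eq))) , upper
    where
    upper : ∀ {z} → z ∉ embed S → z ℤ.≤ + M - + c
    upper { + m} m∉ = m+n≤o⇒m≤o-n m c (≮⇒≥ λ M<m+c → m∉ (m , refl , >M-c⇒∈ M<m+c))
    -- A negative integer is at most -1, and M - c ≥ -1 because M ≥ p J ≥ J = c - 1.
    upper { -[1+ m ]} _ = ℤ.≤-trans (ℤ.-≤- z≤n) (n≤1+m⇒-1≤m-n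
      (≤-trans (≤-reflexive c≡1+J) (s≤s (≤-trans (m≤n*m J p) (m≤n+m (p * J) (c * W))))))

-- Weighted digit sums.

wsum : (ℕ → ℕ) → List (Fin 3) → ℕ
wsum f []       = 0
wsum f (d ∷ ds) = toℕ d * f 1 + wsum (f ∘ suc) ds

wsum-cong : ∀ {f g} → f ≗ g → wsum f ≗ wsum g
wsum-cong f≗g []       = refl
wsum-cong f≗g (d ∷ ds) = cong₂ (λ x y → toℕ d * x + y) (f≗g 1) (wsum-cong (f≗g ∘ suc) ds)

wsum-linear : ∀ a b f g ds → wsum (λ i → a * f i + b * g i) ds ≡ a * wsum f ds + b * wsum g ds
wsum-linear a b f g []       = sym (cong₂ _+_ (*-zeroʳ a) (*-zeroʳ b))
wsum-linear a b f g (d ∷ ds) =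
  trans (cong (λ m → toℕ d * (a * f 1 + b * g 1) + m) (wsum-linear a b (f ∘ suc) (g ∘ suc) ds))
    (lem a b (toℕ d) (f 1) (g 1) _ _)
  where
  lem : ∀ a b d x y z w → d * (a * x + b * y) + (a * z + b * w) ≡ a * (d * x + z) + b * (d * y + w)
  lem = solve-∀

wsum-++ : ∀ f ds es → wsum f (ds ++ es) ≡ wsum f ds + wsum (λ i → f (length ds + i)) es
wsum-++ f []       es = refl
wsum-++ f (d ∷ ds) es = trans (cong (λ m → toℕ d * f 1 + m) (wsum-++ (f ∘ suc) ds es)) (sym (+-assoc (toℕ d * f 1) _ _))

wsum-zeros : ∀ f m → wsum f (replicate m 0₃) ≡ 0
wsum-zeros f zero    = refl
wsum-zeros f (suc m) = wsum-zeros (f ∘ suc) m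

wsum-ones : ∀ f n → wsum f (replicate n 1₃) ≡ ∑[ i < n ] f (suc (toℕ i))
wsum-ones f zero    = refl
wsum-ones f (suc n) = cong₂ _+_ (*-identityˡ (f 1)) (wsum-ones (f ∘ suc) n)

wsum-zeros++1 : ∀ f m → wsum f (replicate m 0₃ ++ [ 1₃ ]) ≡ f (suc m)
wsum-zeros++1 f zero    = lem (f 1)
  where
  lem : ∀ a → 1 * a + 0 ≡ a
  lem = solve-∀
wsum-zeros++1 f (suc m) = wsum-zeros++1 (f ∘ suc) m

weightedSum≡wsum : ∀ {m} (t : Vector (Fin 3) m) f → weightedSum t f ≡ wsum f (toList t)
weightedSum≡wsum {zero}  t f = refl
weightedSum≡wsum {suc m} t f = cong (λ m → toℕ (t Fin.zero) * f 1 + m) (weightedSum≡wsum (t ∘ Fin.suc) (f ∘ suc))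

pow mers : ℕ → ℕ
pow  i = 2 ^ i
mers i = 2 ^ i ∸ 1

-- Horner form: halving the value removes the factor 2 and turns the first digit into the units
-- digit, as one level of `legendre` requires.
wsum-pow-∷ : ∀ d ds → wsum pow (d ∷ ds) ≡ 2 * (toℕ d + wsum pow ds)
wsum-pow-∷ d ds = begin
  toℕ d * 2 + wsum (pow ∘ suc) ds                    ≡⟨ cong (λ m → toℕ d * 2 + m) (wsum-cong (λ i → lem (pow i)) ds) ⟩
  toℕ d * 2 + wsum (λ i → 1 * pow i + 1 * pow i) ds  ≡⟨ cong (λ m → toℕ d * 2 + m) (wsum-linear 1 1 pow pow ds) ⟩
  toℕ d * 2 + (1 * wsum pow ds + 1 * wsum pow ds)    ≡⟨ lem′ (toℕ d) (wsum pow ds) ⟩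
  2 * (toℕ d + wsum pow ds)                          ∎
  where
  open ≡-Reasoning
  lem : ∀ a → 2 * a ≡ 1 * a + 1 * a
  lem = solve-∀
  lem′ : ∀ d a → d * 2 + (1 * a + 1 * a) ≡ 2 * (d + a)
  lem′ = solve-∀

mers-suc : ∀ i → mers (suc i) ≡ pow i + mers i
mers-suc i = trans (cong (λ m → pow i + m ∸ 1) (+-identityʳ (pow i))) (+-∸-assoc (pow i) (m^n>0 2 i))

-- Since 2ⁱ⁺¹ - 1 = 2ⁱ + (2ⁱ - 1), this has the shape of the recursion of `legendre`: the half, plus
-- what the half contributes.
wsum-mers-∷ : ∀ d ds → wsum mers (d ∷ ds) ≡ toℕ d + wsum pow ds + wsum mers ds
wsum-mers-∷ d ds = begin
  toℕ d * 1 + wsum (mers ∘ suc) ds                    ≡⟨ cong (λ m → toℕ d * 1 + m) (wsum-cong (λ i → trans (mers-suc i) (lem (pow i) (mers i))) ds) ⟩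
  toℕ d * 1 + wsum (λ i → 1 * pow i + 1 * mers i) ds  ≡⟨ cong (λ m → toℕ d * 1 + m) (wsum-linear 1 1 pow mers ds) ⟩
  toℕ d * 1 + (1 * wsum pow ds + 1 * wsum mers ds)    ≡⟨ lem′ (toℕ d) (wsum pow ds) (wsum mers ds) ⟩
  toℕ d + wsum pow ds + wsum mers ds                  ∎
  where
  open ≡-Reasoning
  lem : ∀ a b → a + b ≡ 1 * a + 1 * b
  lem = solve-∀
  lem′ : ∀ d a b → d * 1 + (1 * a + 1 * b) ≡ d + a + b
  lem′ = solve-∀

Rep-scale : ∀ d {W j} → Rep W j → Rep (d * W) (d * j)
Rep-scale zero    r = empty
Rep-scale (suc d) r = r ⊕ Rep-scale d r

Rep-wsum : ∀ {f g} → (∀ i → Rep (f i) (g i)) → ∀ ds → Rep (wsum f ds) (wsum g ds)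
Rep-wsum r []       = empty
Rep-wsum r (d ∷ ds) = Rep-scale (toℕ d) (r 1) ⊕ Rep-wsum (r ∘ suc) ds

-- Skew binary numerals and the least W.

Bit : Fin 3 → Set
Bit d = d ≡ 0₃ ⊎ d ≡ 1₃

Bit⇒≤1 : ∀ {d} → Bit d → toℕ d ≤ 1
Bit⇒≤1 (inj₁ refl) = z≤n
Bit⇒≤1 (inj₂ refl) = s≤s z≤n

-- Inductive form of the third condition of `A`; the least significant digit comes first.
data Skew : Pred (List (Fin 3)) 0ℓ where
  []   : Skew []
  0∷_  : ∀ {ds} → Skew ds → Skew (0₃ ∷ ds)
  lead : ∀ d {ds} → All Bit ds → Skew (d ∷ ds)

Bits⇒Skew : ∀ {ds} → All Bit ds → Skew ds
Bits⇒Skew []       = []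
Bits⇒Skew (_ ∷ bs) = lead _ bs

Skew-++ : ∀ {ds es} → Skew ds → All Bit es → Skew (ds ++ es)
Skew-++ []          es = Bits⇒Skew es
Skew-++ (0∷ ds)     es = 0∷ Skew-++ ds es
Skew-++ (lead d ds) es = lead d (All.++⁺ ds es)

Skew-zeros++ : ∀ m {ds} → Skew ds → Skew (replicate m 0₃ ++ ds)
Skew-zeros++ zero    ds = ds
Skew-zeros++ (suc m) ds = 0∷ Skew-zeros++ m ds

Bits-zeros : ∀ m → All Bit (replicate m 0₃)
Bits-zeros m = All.replicate⁺ m (inj₁ refl)

OnlyLeading2 : Pred (List (Fin 3)) 0ℓ
OnlyLeading2 ds = ∀ j → lookup ds j ≡ 2₃ → ∀ i → i Fin.< j → lookup ds i ≡ 0₃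

≢2⇒Bits : ∀ ds → (∀ j → lookup ds j ≢ 2₃) → All Bit ds
≢2⇒Bits []        ≢2 = []
≢2⇒Bits (0₃ ∷ ds) ≢2 = inj₁ refl ∷ ≢2⇒Bits ds (≢2 ∘ Fin.suc)
≢2⇒Bits (1₃ ∷ ds) ≢2 = inj₂ refl ∷ ≢2⇒Bits ds (≢2 ∘ Fin.suc)
≢2⇒Bits (2₃ ∷ ds) ≢2 = contradiction refl (≢2 Fin.zero)

Bits⇒≢2 : ∀ {ds} → All Bit ds → ∀ j → lookup ds j ≢ 2₃
Bits⇒≢2 (inj₁ refl ∷ bs) Fin.zero    ()
Bits⇒≢2 (inj₂ refl ∷ bs) Fin.zero    ()
Bits⇒≢2 (b ∷ bs)         (Fin.suc j) = Bits⇒≢2 bs j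

OnlyLeading2⇒Skew : ∀ ds → OnlyLeading2 ds → Skew ds
OnlyLeading2⇒Skew []                 h = []
OnlyLeading2⇒Skew (0₃ ∷ ds)          h = 0∷ OnlyLeading2⇒Skew ds (λ j eq i i<j → h (Fin.suc j) eq (Fin.suc i) (s≤s i<j))
OnlyLeading2⇒Skew (d@(Fin.suc _) ∷ ds) h = lead d (≢2⇒Bits ds λ j eq → contradiction (h (Fin.suc j) eq Fin.zero (s≤s z≤n)) λ ())

Skew⇒OnlyLeading2 : ∀ {ds} → Skew ds → OnlyLeading2 ds
Skew⇒OnlyLeading2 (0∷ s)      (Fin.suc j) eq Fin.zero    _         = refl
Skew⇒OnlyLeading2 (0∷ s)      (Fin.suc j) eq (Fin.suc i) (s≤s i<j) = Skew⇒OnlyLeading2 s j eq i i<j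
Skew⇒OnlyLeading2 (lead d bs) (Fin.suc j) eq i           _         = contradiction eq (Bits⇒≢2 bs j)

lookup-last-Bit : ∀ ds {e es} → All Bit (e ∷ es) → ∀ j → suc (toℕ j) ≡ length (ds ++ e ∷ es) → Bit (lookup (ds ++ e ∷ es) j)
lookup-last-Bit []           bs j           eq = All.lookup bs (∈-lookup j)
lookup-last-Bit (d ∷ d′ ∷ ds) bs (Fin.suc j) eq = lookup-last-Bit (d′ ∷ ds) bs j (suc-injective eq)
lookup-last-Bit (d ∷ [])     bs (Fin.suc j) eq = lookup-last-Bit [] bs j (suc-injective eq)

⌊e+2*n/2⌋≡n : ∀ {e} n → e ≤ 1 → ⌊ e + 2 * n /2⌋ ≡ n
⌊e+2*n/2⌋≡n n z≤n       = ⌊2*n/2⌋≡n n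
⌊e+2*n/2⌋≡n n (s≤s z≤n) = ⌊1+2*n/2⌋≡n n

-- The places of `ds` start at 1, so `e` is a units bit. Halving discards it and makes the first
-- digit of `ds` the next units bit, which is why the induction carries `e`.
Bits⇒legendre≤ : ∀ {ds} → All Bit ds → ∀ f {e} → e ≤ 1 → legendre f (e + wsum pow ds) ≤ wsum mers ds
Bits⇒legendre≤ bs zero e≤1 = z≤n
Bits⇒legendre≤ [] (suc f) e≤1 rewrite ⌊e+2*n/2⌋≡n 0 e≤1 = Bits⇒legendre≤ [] f z≤n
Bits⇒legendre≤ {d ∷ ds} (b ∷ bs) (suc f) e≤1
  rewrite wsum-pow-∷ d ds | wsum-mers-∷ d ds | ⌊e+2*n/2⌋≡n (toℕ d + wsum pow ds) e≤1 =
  +-monoʳ-≤ (toℕ d + wsum pow ds) (Bits⇒legendre≤ bs f (Bit⇒≤1 b))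

-- The bound is at wsum pow ds - 1; at wsum pow ds itself it fails when a digit 2 occurs.
Skew⇒legendre< : ∀ {ds} → Skew ds → ∀ f {w} → suc w ≡ wsum pow ds → legendre f w < wsum mers ds
Skew⇒legendre< {d ∷ ds} s f {w} eq = subst (legendre f w <_) (sym (wsum-mers-∷ d ds))
  (step f (toℕ d + wsum pow ds) (trans eq (wsum-pow-∷ d ds)) (tail-bound s))
  where
  tail-bound : ∀ {d ds} → Skew (d ∷ ds) → ∀ {u} → toℕ d + wsum pow ds ≡ suc u → ∀ f → legendre f u ≤ wsum mers ds
  tail-bound (0∷ s)      eq f = <⇒≤ (Skew⇒legendre< s f (sym eq))
  -- As `d` is at most 2, `u` is at most `1 + wsum pow ds`: the subtracted 1 turns a possible digit
  -- 2 into a bit.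
  tail-bound (lead d bs) eq f = ≤-trans
    (legendre-mono {f} ≤-refl (≤-pred (≤-trans (≤-reflexive (sym eq)) (+-monoˡ-≤ _ (≤-pred (Fin.toℕ<n d))))))
    (Bits⇒legendre≤ bs f (s≤s z≤n))

  -- `w` is 2 X - 1, whose half is X - 1; the lost unit makes the inequality strict.
  step : ∀ f {w j} X → suc w ≡ 2 * X → (∀ {u} → X ≡ suc u → ∀ f → legendre f u ≤ j) → legendre f w < X + j
  step zero    (suc u) eq bound = s≤s z≤n
  step (suc f) {w} {j} (suc u) eq bound = s≤s (subst (λ h → h + legendre f h ≤ u + j) (sym ⌊w/2⌋≡u) (+-monoʳ-≤ u (bound refl f)))
    where
    lem : ∀ u → 2 * suc u ≡ suc (suc (2 * u))
    lem = solve-∀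
    ⌊w/2⌋≡u : ⌊ w /2⌋ ≡ u
    ⌊w/2⌋≡u = trans (cong ⌊_/2⌋ (suc-injective (trans eq (lem u)))) (⌊1+2*n/2⌋≡n u)

-- If W were smaller, it would be at most `wsum pow ds` - 1, where `legendre` is still below
-- `wsum mers ds`, contradicting the bound on `j`.
Skew-minimal : ∀ {ds W j} → Skew ds → Rep W j → wsum mers ds ≤ j → wsum pow ds ≤ W
Skew-minimal {ds} {W} {j} s r ≤j = ≮⇒≥ λ W< →
  let d , eq = m≤n⇒∃[o]m+o≡n W<
      f , j≤ = Rep⇒≤legendre r
  in <⇒≱ (Skew⇒legendre< s f eq) (≤-trans ≤j (≤-trans j≤ (legendre-mono {f} ≤-refl (m≤m+n W d))))

wsum-mers-snoc : ∀ ds d → wsum mers (ds ++ [ d ]) ≡ wsum mers ds + toℕ d * mers (suc (length ds))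
wsum-mers-snoc ds d = trans (wsum-++ mers ds [ d ]) (cong (λ m → wsum mers ds + m)
  (trans (+-identityʳ _) (cong (λ i → toℕ d * mers i) (+-comm (length ds) 1))))

-- Existence of skew binary expansions.

-- Greedy choice of the leading (last) digit.
skewRepresentation : ∀ m {j} → j + 2 ≤ 2 ^ suc m → ∃ λ ds → length ds ≡ m × Skew ds × wsum mers ds ≡ j
skewRepresentation zero {zero}  j+2≤ = [] , refl , [] , refl
skewRepresentation zero {suc j} j+2≤ = contradiction (≤-trans (≤-reflexive (+-comm 2 j)) (≤-pred j+2≤)) λ { (s≤s ()) }
skewRepresentation (suc m) {j} j+2≤ with j + 2 ≤? 2 ^ suc m
... | yes j+2≤′ with skewRepresentation m j+2≤′
...   | ds , refl , s , refl = ds ++ [ 0₃ ] , trans (length-++ ds) (+-comm _ 1) , Skew-++ s (inj₁ refl ∷ []) ,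
  trans (wsum-mers-snoc ds 0₃) (+-identityʳ _)
skewRepresentation (suc m) {j} j+2≤ | no j+2≰ with m≤n⇒∃[o]m+o≡n (q≤j)
  where
  q≤j : mers (suc m) ≤ j
  q≤j = ≤-pred (≤-pred (≤-trans (s≤s (≤-reflexive (suc[2^n∸1]≡2^n (suc m)))) (≤-trans (≰⇒> j+2≰) (≤-reflexive (+-comm j 2)))))
... | r , refl with r + 2 ≤? 2 ^ suc m
...   | yes r+2≤ with skewRepresentation m r+2≤
...     | ds , refl , s , refl = ds ++ [ 1₃ ] , trans (length-++ ds) (+-comm _ 1) , Skew-++ s (inj₂ refl ∷ []) ,
  trans (wsum-mers-snoc ds 1₃) (lem (wsum mers ds) (mers (suc (length ds))))
  where
  lem : ∀ a b → a + 1 * b ≡ b + a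
  lem = solve-∀
-- Subtracting `q` once leaves `r ≥ q`, while the bound on `j` gives `r ≤ q`. Hence j = 2 q: the
-- leading digit is 2 and all lower digits are 0.
skewRepresentation (suc m) j+2≤ | no _ | r , refl | no r+2≰ =
  replicate m 0₃ ++ [ 2₃ ] ,
  trans (length-++ (replicate m 0₃)) (trans (cong (_+ 1) (length-replicate m)) (+-comm m 1)) ,
  Skew-zeros++ m (lead 2₃ []) ,
  trans (wsum-mers-snoc (replicate m 0₃) 2₃)
    (trans (cong₂ (λ a b → a + 2 * mers (suc b)) (wsum-zeros mers m) (length-replicate m))
      (trans (cong (λ m → q + m) (+-identityʳ q)) (cong (λ m → q + m) (≤-antisym q≤r r≤q))))
  where
  q = mers (suc m)
  q≤r : q ≤ r
  q≤r = ≤-pred (≤-pred (≤-trans (s≤s (≤-reflexive (suc[2^n∸1]≡2^n (suc m)))) (≤-trans (≰⇒> r+2≰) (≤-reflexive (+-comm r 2)))))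
  lem₁ : ∀ q r → q + r + 2 ≡ suc q + suc r
  lem₁ = solve-∀
  lem₂ : ∀ q → 2 * suc q ≡ suc q + suc q
  lem₂ = solve-∀
  r≤q : r ≤ q
  r≤q = ≤-pred (+-cancelˡ-≤ (suc q) _ _ (≤-trans (≤-reflexive (sym (lem₁ q r)))
    (≤-trans j+2≤ (≤-reflexive (trans (cong (2 *_) (sym (suc[2^n∸1]≡2^n (suc m)))) (lem₂ q))))))

fromList : ∀ {m} ds → length ds ≡ m → ∃ λ (t : Vector (Fin 3) m) → toList t ≡ ds
fromList ds refl = lookup ds , tabulate-lookup ds

skewVector : ∀ m {j} → j + 2 ≤ 2 ^ suc m → ∃ λ (t : Vector (Fin 3) m) → Skew (toList t) × weightedSum t mers ≡ j
skewVector m j+2≤ with skewRepresentation m j+2≤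
... | ds , len , s , eq with fromList ds len
...   | t , refl = t , s , trans (weightedSum≡wsum t mers) eq

n+2≤2^[1+n] : ∀ n → n + 2 ≤ 2 ^ suc n
n+2≤2^[1+n] zero    = ≤-refl
n+2≤2^[1+n] (suc n) = ≤-trans (+-mono-≤ (m^n>0 2 (suc n)) (n+2≤2^[1+n] n))
  (+-monoʳ-≤ (2 ^ suc n) (≤-reflexive (sym (+-identityʳ _))))

-- The semigroup GT(n,k) in terms of c and p.

∣2^k∸1⇒Coprime-2 : ∀ {d m k} .{{_ : NonZero k}} → suc m ≡ 2 ^ k → d ∣ m → Coprime d 2
∣2^k∸1⇒Coprime-2 {d} {m} {suc k} eq d∣m {e} (e∣d , e∣2) = ∣1⇒≡1
  (∣m+n∣m⇒∣n (subst (e ∣_) (trans (sym eq) (+-comm 1 m)) (∣-trans e∣2 (m∣m*n (2 ^ k)))) (∣-trans e∣d d∣m))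

Coprime-2∧∣2^m⇒≡1 : ∀ {d} → Coprime d 2 → ∀ m → d ∣ 2 ^ m → d ≡ 1
Coprime-2∧∣2^m⇒≡1 cop zero    d∣ = ∣1⇒≡1 d∣
Coprime-2∧∣2^m⇒≡1 cop (suc m) d∣ = Coprime-2∧∣2^m⇒≡1 cop m (coprime-divisor cop d∣)

+-linear : ∀ c p W j W′ j′ → (c * W + p * j) + (c * W′ + p * j′) ≡ c * (W + W′) + p * (j + j′)
+-linear = solve-∀

module _ (n k : ℕ) .{{_ : NonZero k}} where

  private
    c = s n k 0
    p = 2 ^ k ∸ 1

  s+p : ∀ i → s n k i + p ≡ (2 ^ k + 1) * 2 ^ (n + i)
  s+p i = m∸n+n≡m (≤-trans (m∸n≤m (2 ^ k) 1) (≤-trans (m≤m+n (2 ^ k) 1) (m≤m*n (2 ^ k + 1) (2 ^ (n + i)) {{m^n≢0 2 (n + i)}})))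

  c+p : c + p ≡ (2 ^ k + 1) * 2 ^ n
  c+p = trans (s+p 0) (cong (λ m → (2 ^ k + 1) * 2 ^ m) (+-identityʳ n))

  -- After adding `p` both sides equal (c + p) 2ⁱ, and no truncated subtraction remains in `s`.
  s≡c*2^i+p*mers : ∀ i → s n k i ≡ c * pow i + p * mers i
  s≡c*2^i+p*mers i = +-cancelʳ-≡ p _ _ (begin
    s n k i + p                        ≡⟨ s+p i ⟩
    (2 ^ k + 1) * 2 ^ (n + i)          ≡⟨ cong ((2 ^ k + 1) *_) (^-distribˡ-+-* 2 n i) ⟩
    (2 ^ k + 1) * (2 ^ n * pow i)      ≡⟨ *-assoc (2 ^ k + 1) (2 ^ n) (pow i) ⟨
    (2 ^ k + 1) * 2 ^ n * pow i        ≡⟨ cong (_* pow i) c+p ⟨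
    (c + p) * pow i                    ≡⟨ cong ((c + p) *_) (suc[2^n∸1]≡2^n i) ⟨
    (c + p) * suc (mers i)             ≡⟨ lem c p (mers i) ⟩
    c * suc (mers i) + p * mers i + p  ≡⟨ cong (λ m → c * m + p * mers i + p) (suc[2^n∸1]≡2^n i) ⟩
    c * pow i + p * mers i + p         ∎)
    where
    open ≡-Reasoning
    lem : ∀ c p m → (c + p) * suc m ≡ c * suc m + p * m + p
    lem = solve-∀

  wsum-s : ∀ ds → wsum (s n k) ds ≡ c * wsum pow ds + p * wsum mers ds
  wsum-s ds = trans (wsum-cong s≡c*2^i+p*mers ds) (wsum-linear c p pow mers ds)

  Rep⇒∈GT : ∀ {W j} → Rep W j → c * W + p * j ∈ GT n k
  Rep⇒∈GT empty     = subst (_∈ GT n k) (sym (cong₂ _+_ (*-zeroʳ c) (*-zeroʳ p))) 0∈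
  Rep⇒∈GT (power i) = subst (_∈ GT n k) (s≡c*2^i+p*mers i) (gen (i , refl))
  Rep⇒∈GT (_⊕_ {W} {j} {W′} {j′} r r′) = subst (_∈ GT n k) (+-linear c p W j W′ j′) (+∈ (Rep⇒∈GT r) (Rep⇒∈GT r′))
  ∈GT⇒Rep : ∀ {x} → x ∈ GT n k → ∃₂ λ W j → Rep W j × x ≡ c * W + p * j
  ∈GT⇒Rep (gen (i , refl)) = pow i , mers i , power i , s≡c*2^i+p*mers i
  ∈GT⇒Rep 0∈               = 0 , 0 , empty , sym (cong₂ _+_ (*-zeroʳ c) (*-zeroʳ p))
  ∈GT⇒Rep (+∈ x∈ y∈) with ∈GT⇒Rep x∈ | ∈GT⇒Rep y∈
  ... | W , j , r , refl | W′ , j′ , r′ , refl = W + W′ , j + j′ , r ⊕ r′ , +-linear c p W j W′ j′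
  -- A common divisor divides c + p = (2ᵏ + 1) 2ⁿ. It is odd, as a divisor of 2ᵏ - 1, and therefore
  -- coprime to 2ᵏ + 1 = p + 2 and to 2ⁿ.
  c-coprime-p : Coprime c p
  c-coprime-p {d} (d∣c , d∣p) = Coprime-2∧∣2^m⇒≡1 odd n (coprime-divisor cop (subst (d ∣_) c+p (∣m∣n⇒∣m+n d∣c d∣p)))
    where
    odd : Coprime d 2
    odd = ∣2^k∸1⇒Coprime-2 {k = k} (suc[2^n∸1]≡2^n k) d∣p
    cop : Coprime d (2 ^ k + 1)
    cop {e} (e∣d , e∣2^k+1) = odd (e∣d , ∣m+n∣m⇒∣n (subst (e ∣_) 2^k+1≡p+2 e∣2^k+1) (∣-trans e∣d d∣p))
      where
      2^k+1≡p+2 : 2 ^ k + 1 ≡ p + 2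
      2^k+1≡p+2 = trans (cong (_+ 1) (sym (suc[2^n∸1]≡2^n k))) (sym (+-suc p 1))

  p>0 : p > 0
  p>0 = ≤-pred (≤-trans (^-monoʳ-≤ 2 (>-nonZero⁻¹ k)) (≤-reflexive (sym (suc[2^n∸1]≡2^n k))))

  c>0 : c > 0
  c>0 = +-cancelʳ-< p 0 c (begin-strict
    p                    <⟨ n<1+n p ⟩
    suc p                ≡⟨ suc[2^n∸1]≡2^n k ⟩
    2 ^ k                ≤⟨ m≤m+n (2 ^ k) 1 ⟩
    2 ^ k + 1            ≤⟨ m≤m*n (2 ^ k + 1) (2 ^ n) {{m^n≢0 2 n}} ⟩
    (2 ^ k + 1) * 2 ^ n  ≡⟨ c+p ⟨
    c + p                ∎)
    where open ≤-Reasoning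

  -- The digits expand s₀ - 1 in the weights 2ⁱ - 1, written without subtraction.
  Expands : Pred (List (Fin 3)) 0ℓ
  Expands ds = Skew ds × wsum mers ds + 2 ^ k ≡ (2 ^ k + 1) * 2 ^ n

  -- The equation in `Expands` says that `wsum mers ds` is c - 1, and `Skew-minimal` makes
  -- `wsum pow ds` the least W for it.
  Expands⇒ : ∀ {ds} → Expands ds → Greatest _≤_ (Ap (GT n k) c) (wsum (s n k) ds) ×
    IsFrobeniusNumber (GT n k) (+ wsum (s n k) ds - + c)
  Expands⇒ {ds} (sk , eq) rewrite wsum-s ds =
    Ap-greatest Rep⇒∈GT ∈GT⇒Rep c-coprime-p c≡ rep (Skew-minimal sk) ,
    frobenius Rep⇒∈GT ∈GT⇒Rep c-coprime-p c≡ rep (Skew-minimal sk)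
    where
    instance
      c≢0 : NonZero c
      c≢0 = >-nonZero c>0
      p≢0 : NonZero p
      p≢0 = >-nonZero p>0
    rep : Rep (wsum pow ds) (wsum mers ds)
    rep = Rep-wsum power ds
    c≡ : c ≡ suc (wsum mers ds)
    c≡ = +-cancelʳ-≡ p _ _ (trans c+p (trans (sym eq) (trans (cong (λ m → wsum mers ds + m) (sym (suc[2^n∸1]≡2^n k))) (+-suc _ p))))

  -- Provides one maximum for all cases at once. `J` places suffice because J + 2 ≤ 2ᴶ⁺¹.
  expansion : ∃ Expands
  expansion =
    let ds , _ , sk , eq = skewRepresentation J (n+2≤2^[1+n] J)
    in ds , sk , (begin
      wsum mers ds + 2 ^ k  ≡⟨ cong₂ _+_ eq (sym (suc[2^n∸1]≡2^n k)) ⟩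
      J + suc p             ≡⟨ +-suc J p ⟩
      suc J + p             ≡⟨ cong (_+ p) (m+[n∸m]≡n c>0) ⟩
      c + p                 ≡⟨ c+p ⟩
      (2 ^ k + 1) * 2 ^ n   ∎)
    where
    open ≡-Reasoning
    J = c ∸ 1

-- Weighted sums of the digit patterns.

wsum-zeros++11 : ∀ f m → wsum f (replicate m 0₃ ++ 1₃ ∷ 1₃ ∷ []) ≡ f (suc m) + f (suc m + 1)
wsum-zeros++11 f zero    = lem (f 1) (f 2)
  where
  lem : ∀ a b → 1 * a + (1 * b + 0) ≡ a + b
  lem = solve-∀
wsum-zeros++11 f (suc m) = wsum-zeros++11 (f ∘ suc) m

wsum-1zeros1 : ∀ f {m} (t : Vector (Fin 3) m) k →
  wsum f (toList t ++ 1₃ ∷ replicate k 0₃ ++ [ 1₃ ]) ≡ weightedSum t f + f (suc m) + f (suc (suc m) + k)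
wsum-1zeros1 f {m} t k = begin
  wsum f (toList t ++ 1₃ ∷ replicate k 0₃ ++ [ 1₃ ])
    ≡⟨ wsum-++ f (toList t) _ ⟩
  wsum f (toList t) + (1 * f (l + 1) + wsum (λ i → f (l + suc i)) (replicate k 0₃ ++ [ 1₃ ]))
    ≡⟨ cong₂ (λ x y → x + (1 * f (l + 1) + y)) (sym (weightedSum≡wsum t f)) (wsum-zeros++1 _ k) ⟩
  weightedSum t f + (1 * f (l + 1) + f (l + suc (suc k)))
    ≡⟨ cong (λ l → weightedSum t f + (1 * f (l + 1) + f (l + suc (suc k)))) (length-tabulate t) ⟩
  weightedSum t f + (1 * f (m + 1) + f (m + suc (suc k)))
    ≡⟨ cong₂ (λ i j → weightedSum t f + (1 * f i + f j)) (+-comm m 1) (trans (+-suc m (suc k)) (cong suc (+-suc m k))) ⟩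
  weightedSum t f + (1 * f (suc m) + f (suc (suc m) + k))
    ≡⟨ lem (weightedSum t f) (f (suc m)) (f (suc (suc m) + k)) ⟩
  weightedSum t f + f (suc m) + f (suc (suc m) + k)
    ∎
  where
  open ≡-Reasoning
  l = length (toList t)
  lem : ∀ a b c → a + (1 * b + c) ≡ a + b + c
  lem = solve-∀

wsum-ones-suffix : ∀ f {m} (t : Vector (Fin 3) m) n →
  wsum f (toList t ++ replicate n 1₃) ≡ weightedSum t f + (∑[ i < n ] f (suc m + toℕ i))
wsum-ones-suffix f {m} t n = begin
  wsum f (toList t ++ replicate n 1₃)
    ≡⟨ wsum-++ f (toList t) _ ⟩
  wsum f (toList t) + wsum (λ i → f (length (toList t) + i)) (replicate n 1₃)
    ≡⟨ cong₂ _+_ (sym (weightedSum≡wsum t f))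
         (trans (wsum-cong (λ i → cong (λ l → f (l + i)) (length-tabulate t)) (replicate n 1₃)) (wsum-ones _ n)) ⟩
  weightedSum t f + (∑[ i < n ] f (m + suc (toℕ i)))
    ≡⟨ cong (λ x → weightedSum t f + x) (sum-cong-≗ {n} (λ i → cong f (+-suc m (toℕ i)))) ⟩
  weightedSum t f + (∑[ i < n ] f (suc m + toℕ i))
    ∎
  where open ≡-Reasoning

-- The numbers f(i) + 1 form a geometric progression of ratio 2; the summand `n` collects the added
-- ones.
geometric : ∀ n (f : ℕ → ℕ) → (∀ i → suc (f (suc i)) ≡ 2 * suc (f i)) → (∑[ i < n ] f (toℕ i)) + n + suc (f 0) ≡ 2 ^ n * suc (f 0)
geometric zero    f double = sym (+-identityʳ _)
geometric (suc n) f double = begin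
  f 0 + Σ + suc n + suc (f 0)      ≡⟨ lem₁ (f 0) Σ n ⟩
  Σ + n + 2 * suc (f 0)            ≡⟨ cong (λ m → Σ + n + m) (double 0) ⟨
  Σ + n + suc (f 1)                ≡⟨ geometric n (f ∘ suc) (double ∘ suc) ⟩
  2 ^ n * suc (f 1)                ≡⟨ cong (2 ^ n *_) (double 0) ⟩
  2 ^ n * (2 * suc (f 0))          ≡⟨ lem₂ (2 ^ n) (suc (f 0)) ⟩
  2 ^ suc n * suc (f 0)            ∎
  where
  open ≡-Reasoning
  Σ = ∑[ i < n ] f (suc (toℕ i))
  lem₁ : ∀ a b n → a + b + suc n + suc a ≡ b + n + 2 * suc a
  lem₁ = solve-∀
  lem₂ : ∀ a b → a * (2 * b) ≡ (2 * a) * b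
  lem₂ = solve-∀

∑-mers : ∀ n k → (∑[ i < n ] mers (k + toℕ i)) + n + 2 ^ k ≡ 2 ^ n * 2 ^ k
∑-mers n k = begin
  Σ + n + 2 ^ k                ≡⟨ cong (λ m → Σ + n + m) eq ⟨
  Σ + n + suc (mers (k + 0))   ≡⟨ geometric n (λ i → mers (k + i)) double ⟩
  2 ^ n * suc (mers (k + 0))   ≡⟨ cong (2 ^ n *_) eq ⟩
  2 ^ n * 2 ^ k                ∎
  where
  open ≡-Reasoning
  Σ = ∑[ i < n ] mers (k + toℕ i)
  eq : suc (mers (k + 0)) ≡ 2 ^ k
  eq = trans (suc[2^n∸1]≡2^n (k + 0)) (cong pow (+-identityʳ k))
  double : ∀ i → suc (mers (k + suc i)) ≡ 2 * suc (mers (k + i))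
  double i = trans (suc[2^n∸1]≡2^n (k + suc i)) (trans (cong pow (+-suc k i)) (cong (2 *_) (sym (suc[2^n∸1]≡2^n (k + i)))))

-- Lengths and membership in A.

δ-≤ : ∀ {n k} → n ≢ 0 → k ≤ n → δ n k ≡ k
δ-≤ {zero}      n≢0 k≤n = contradiction refl n≢0
δ-≤ {suc n} {k} n≢0 k≤n rewrite dec-true (k ≤? suc n) k≤n = refl

δ-> : ∀ {n k} → n ≢ 0 → k > n → δ n k ≡ k ∸ 1
δ-> {zero}      n≢0 k>n = contradiction refl n≢0
δ-> {suc n} {k} n≢0 k>n rewrite dec-false (k ≤? suc n) (<⇒≱ k>n) = refl

-- The suffix of bits is nonempty, so it contains the last digit, which therefore is not 2.
∈A : ∀ n d ds {e es} → length (ds ++ e ∷ es) ≡ n + d → Skew ds → All Bit (e ∷ es) → ds ++ e ∷ es ∈ A n d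
∈A n d ds len sk bs = len , (λ j eq → lookup-last-Bit ds bs j (trans eq (sym len))) , Skew⇒OnlyLeading2 (Skew-++ sk bs)

Bits-1zeros1 : ∀ k → All Bit (1₃ ∷ replicate k 0₃ ++ [ 1₃ ])
Bits-1zeros1 k = inj₂ refl ∷ All.++⁺ (Bits-zeros k) (inj₂ refl ∷ [])

-- The case 2 ≤ k < n.

module _ (m k : ℕ) (2≤k : 2 ≤ k) (k<n : k < suc (suc m)) where

  private
    n = suc (suc m)

  instance
    k≢0 : NonZero k
    k≢0 = >-nonZero (≤-trans (s≤s z≤n) 2≤k)

  2^k≤ : 2 ^ k ≤ 2 ^ suc m
  2^k≤ = ^-monoʳ-≤ 2 (≤-pred k<n)

  -- (2ⁿ⁻¹ - 2ᵏ + 2) + (2ⁿ⁻¹ - 1) + (2ⁿ⁺ᵏ - 1) + 2ᵏ = 2ⁿ + 2ⁿ⁺ᵏ.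
  Coeffs-k<n⇒Expands : ∀ {t} → t ∈ Coeffs-k<n n k → Expands n k (toList t ++ 1₃ ∷ replicate k 0₃ ++ [ 1₃ ])
  Coeffs-k<n⇒Expands {t} ((_ , _ , only) , eq) = OnlyLeading2⇒Skew _ only , (begin
    wsum mers (toList t ++ 1₃ ∷ replicate k 0₃ ++ [ 1₃ ]) + 2 ^ k
      ≡⟨ cong (_+ 2 ^ k) (wsum-1zeros1 mers t k) ⟩
    weightedSum t mers + a + b + 2 ^ k
      ≡⟨ cong (λ x → x + a + b + 2 ^ k) eq ⟩
    (2 ^ suc m ∸ 2 ^ k) + 2 + a + b + 2 ^ k
      ≡⟨ lem₁ (2 ^ suc m ∸ 2 ^ k) a b (2 ^ k) ⟩
    ((2 ^ suc m ∸ 2 ^ k) + 2 ^ k) + suc a + suc b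
      ≡⟨ cong₂ (λ x y → x + y + suc b) (m∸n+n≡m 2^k≤) (suc[2^n∸1]≡2^n (suc m)) ⟩
    2 ^ suc m + 2 ^ suc m + suc b
      ≡⟨ cong (λ x → 2 ^ suc m + 2 ^ suc m + x) (trans (suc[2^n∸1]≡2^n (n + k)) (^-distribˡ-+-* 2 n k)) ⟩
    2 ^ suc m + 2 ^ suc m + 2 * 2 ^ suc m * 2 ^ k
      ≡⟨ lem₂ (2 ^ suc m) (2 ^ k) ⟩
    (2 ^ k + 1) * 2 ^ n
      ∎)
    where
    open ≡-Reasoning
    a = mers (suc m)
    b = mers (n + k)
    lem₁ : ∀ d a b K → d + 2 + a + b + K ≡ (d + K) + suc a + suc b
    lem₁ = solve-∀
    lem₂ : ∀ X K → X + X + 2 * X * K ≡ (K + 1) * (2 * X)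
    lem₂ = solve-∀

  -- The target fits into n - 2 places when 2ⁿ⁻¹ - 2ᵏ + 4 ≤ 2ⁿ⁻¹, that is, when `k ≥ 2`.
  ∃Coeffs-k<n : ∃ λ t → t ∈ Coeffs-k<n n k
  ∃Coeffs-k<n =
    let t , sk , eq = skewVector m {(2 ^ suc m ∸ 2 ^ k) + 2} bound
    in t , ∈A n (δ n k) (toList t) (len t) sk (Bits-1zeros1 k) , eq
    where
    bound : (2 ^ suc m ∸ 2 ^ k) + 2 + 2 ≤ 2 ^ suc m
    bound = begin
      (2 ^ suc m ∸ 2 ^ k) + 2 + 2  ≡⟨ +-assoc (2 ^ suc m ∸ 2 ^ k) 2 2 ⟩
      (2 ^ suc m ∸ 2 ^ k) + 2 ^ 2  ≤⟨ +-monoʳ-≤ (2 ^ suc m ∸ 2 ^ k) (^-monoʳ-≤ 2 2≤k) ⟩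
      (2 ^ suc m ∸ 2 ^ k) + 2 ^ k  ≡⟨ m∸n+n≡m 2^k≤ ⟩
      2 ^ suc m                    ∎
      where open ≤-Reasoning
    len : ∀ (t : Vector (Fin 3) m) → length (toList t ++ 1₃ ∷ replicate k 0₃ ++ [ 1₃ ]) ≡ n + δ n k
    len t = begin
      length (toList t ++ 1₃ ∷ replicate k 0₃ ++ [ 1₃ ])
        ≡⟨ length-++ (toList t) ⟩
      length (toList t) + suc (length (replicate k 0₃ ++ [ 1₃ ]))
        ≡⟨ cong₂ (λ x y → x + suc y) (length-tabulate t)
             (trans (length-++ (replicate k 0₃)) (cong (_+ 1) (length-replicate k))) ⟩
      m + suc (k + 1)
        ≡⟨ lem m k ⟩
      n + k
        ≡⟨ cong (λ x → n + x) (δ-≤ {n} {k} (λ ()) (<⇒≤ k<n)) ⟨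
      n + δ n k
        ∎
      where
      open ≡-Reasoning
      lem : ∀ m k → m + suc (k + 1) ≡ suc (suc m) + k
      lem = solve-∀

-- The case k > n ≥ 1, with `suc k` in the role of k.

module _ (n k : ℕ) (n≢0 : n ≢ 0) (k>n : suc k > n) where

  -- By `∑-mers` the block of ones, together with `n` and `2 ^ suc k`, gives `2 ^ n * 2 ^ suc k`;
  -- the remaining `2 ^ n` completes the product.
  Coeffs-k>n⇒Expands : ∀ {t} → t ∈ Coeffs-k>n n (suc k) → Expands n (suc k) (toList t ++ replicate n 1₃)
  Coeffs-k>n⇒Expands {t} ((_ , _ , only) , eq) = OnlyLeading2⇒Skew _ only , (begin
    wsum mers (toList t ++ replicate n 1₃) + 2 ^ suc k
      ≡⟨ cong (_+ 2 ^ suc k) (wsum-ones-suffix mers t n) ⟩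
    weightedSum t mers + Σ + 2 ^ suc k
      ≡⟨ cong (λ x → x + Σ + 2 ^ suc k) eq ⟩
    2 ^ n + n + Σ + 2 ^ suc k
      ≡⟨ lem₁ (2 ^ n) n Σ (2 ^ suc k) ⟩
    2 ^ n + (Σ + n + 2 ^ suc k)
      ≡⟨ cong (λ x → 2 ^ n + x) (∑-mers n (suc k)) ⟩
    2 ^ n + 2 ^ n * 2 ^ suc k
      ≡⟨ lem₂ (2 ^ n) (2 ^ suc k) ⟩
    (2 ^ suc k + 1) * 2 ^ n
      ∎)
    where
    open ≡-Reasoning
    Σ = ∑[ i < n ] mers (suc k + toℕ i)
    lem₁ : ∀ N n z K → N + n + z + K ≡ N + (z + n + K)
    lem₁ = solve-∀
    lem₂ : ∀ N K → N + N * K ≡ (K + 1) * N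
    lem₂ = solve-∀

  ∃Coeffs-k>n : suc k ≢ 2 → ∃ λ t → t ∈ Coeffs-k>n n (suc k)
  ∃Coeffs-k>n k≢2 =
    let t , sk , eq = skewVector k {2 ^ n + n} (bound n n≢0 k>n)
    in t , mem n n≢0 t sk (len t) , eq
    where
    2+n+2≤2^[2+n] : ∀ n → suc (suc n) + 2 ≤ 2 ^ suc (suc n)
    2+n+2≤2^[2+n] zero    = ≤-refl
    2+n+2≤2^[2+n] (suc n) = ≤-trans (+-mono-≤ (m^n>0 2 (suc (suc n))) (2+n+2≤2^[2+n] n))
      (+-monoʳ-≤ (2 ^ suc (suc n)) (≤-reflexive (sym (+-identityʳ _))))
    bound : ∀ n → n ≢ 0 → suc k > n → 2 ^ n + n + 2 ≤ 2 ^ suc k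
    bound zero          n≢0 k>n = contradiction refl n≢0
    -- For n = 1 the claim is 5 ≤ `2 ^ suc k`, which needs an exponent of at least 3; this is where
    -- exponent 2 must be excluded.
    bound (suc zero)    n≢0 k>n = ≤-trans (m≤m+n 5 3) (^-monoʳ-≤ 2 (≤∧≢⇒< k>n (k≢2 ∘ sym)))
    bound (suc (suc n)) n≢0 k>n = begin
      2 ^ suc (suc n) + suc (suc n) + 2      ≡⟨ +-assoc (2 ^ suc (suc n)) (suc (suc n)) 2 ⟩
      2 ^ suc (suc n) + (suc (suc n) + 2)    ≤⟨ +-monoʳ-≤ (2 ^ suc (suc n)) (2+n+2≤2^[2+n] n) ⟩
      2 ^ suc (suc n) + 2 ^ suc (suc n)      ≡⟨ cong (λ x → 2 ^ suc (suc n) + x) (+-identityʳ _) ⟨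
      2 ^ suc (suc (suc n))                  ≤⟨ ^-monoʳ-≤ 2 k>n ⟩
      2 ^ suc k                              ∎
      where open ≤-Reasoning
    len : ∀ (t : Vector (Fin 3) k) → length (toList t ++ replicate n 1₃) ≡ n + δ n (suc k)
    len t = begin
      length (toList t ++ replicate n 1₃)      ≡⟨ length-++ (toList t) ⟩
      length (toList t) + length (replicate n 1₃) ≡⟨ cong₂ _+_ (length-tabulate t) (length-replicate n) ⟩
      k + n                                    ≡⟨ +-comm k n ⟩
      n + k                                    ≡⟨ cong (λ x → n + x) (δ-> n≢0 k>n) ⟨
      n + δ n (suc k)                          ∎
      where open ≡-Reasoning
    mem : ∀ n → n ≢ 0 → (t : Vector (Fin 3) k) → Skew (toList t) →
      length (toList t ++ replicate n 1₃) ≡ n + δ n (suc k) →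
      toList t ++ replicate n 1₃ ∈ A n (δ n (suc k))
    mem zero    n≢0 t sk len = contradiction refl n≢0
    mem (suc n) n≢0 t sk len = ∈A (suc n) (δ (suc n) (suc k)) (toList t) len sk (All.replicate⁺ (suc n) (inj₂ refl))

-- The cases n = 0, k = 1 and n = k.

module _ (k : ℕ) .{{_ : NonZero k}} where

  Expands-n≡0 : Expands 0 k [ 1₃ ]
  Expands-n≡0 = lead 1₃ [] , lem (2 ^ k)
    where
    lem : ∀ K → 1 + K ≡ (K + 1) * 1
    lem = solve-∀

  s₀≡2 : s 0 k 0 ≡ 2
  s₀≡2 = +-cancelʳ-≡ (2 ^ k ∸ 1) _ _ (trans (c+p 0 k) (trans (lem (2 ^ k)) (cong suc (sym (suc[2^n∸1]≡2^n k)))))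
    where
    lem : ∀ K → (K + 1) * 1 ≡ suc K
    lem = solve-∀

Expands-k≡1 : ∀ m → Expands (suc m) 1 (replicate m 0₃ ++ 1₃ ∷ 1₃ ∷ [])
Expands-k≡1 m = Skew-zeros++ m (lead 1₃ (inj₂ refl ∷ [])) , (begin
  wsum mers (replicate m 0₃ ++ 1₃ ∷ 1₃ ∷ []) + 2       ≡⟨ cong (_+ 2) (wsum-zeros++11 mers m) ⟩
  mers (suc m) + mers (suc m + 1) + 2                  ≡⟨ lem₁ (mers (suc m)) (mers (suc m + 1)) ⟩
  suc (mers (suc m)) + suc (mers (suc m + 1))          ≡⟨ cong₂ _+_ (suc[2^n∸1]≡2^n (suc m))
                                                             (trans (suc[2^n∸1]≡2^n (suc m + 1)) (^-distribˡ-+-* 2 (suc m) 1)) ⟩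
  2 ^ suc m + 2 ^ suc m * 2                            ≡⟨ lem₂ (2 ^ suc m) ⟩
  3 * 2 ^ suc m                                        ∎)
  where
  open ≡-Reasoning
  lem₁ : ∀ a b → a + b + 2 ≡ suc a + suc b
  lem₁ = solve-∀
  lem₂ : ∀ a → a + a * 2 ≡ 3 * a
  lem₂ = solve-∀

-- Ones at places 1 and 2n: 1 + (2²ⁿ - 1) + 2ⁿ = (2ⁿ + 1) 2ⁿ.
Expands-n≡k : ∀ m → Expands (suc m) (suc m) (1₃ ∷ replicate (m + m) 0₃ ++ [ 1₃ ])
Expands-n≡k m = lead 1₃ (All.++⁺ (Bits-zeros (m + m)) (inj₂ refl ∷ [])) , (begin
  1 + wsum (mers ∘ suc) (replicate (m + m) 0₃ ++ [ 1₃ ]) + X  ≡⟨ cong (λ x → 1 + x + X) (wsum-zeros++1 (mers ∘ suc) (m + m)) ⟩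
  suc (mers (suc (suc (m + m)))) + X                          ≡⟨ cong (_+ X) (trans (suc[2^n∸1]≡2^n (suc (suc (m + m))))
                                                                   (cong (λ x → 2 ^ suc x) (sym (+-suc m m)))) ⟩
  2 ^ (suc m + suc m) + X                                     ≡⟨ cong (_+ X) (^-distribˡ-+-* 2 (suc m) (suc m)) ⟩
  X * X + X                                                   ≡⟨ lem X ⟩
  (X + 1) * X                                                 ∎)
  where
  open ≡-Reasoning
  X = 2 ^ suc m
  lem : ∀ a → a * a + a ≡ (a + 1) * a
  lem = solve-∀

-- Comparison of expansions and assembly of the cases.

module _ (n k : ℕ) .{{_ : NonZero k}} where

  maxAp : ℕ
  maxAp = wsum (s n k) (proj₁ (expansion n k))

  HasMax : ℕ → Set
  HasMax X = maxAp ≡ X × + maxAp - + s n k 0 ≡ + X - + s n k 0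

  -- Both expansions yield a greatest element of the same Apéry set, so antisymmetry identifies them
  -- and one expansion settles each case.
  Expands⇒HasMax : ∀ {ds X} → Expands n k ds → wsum (s n k) ds ≡ X → HasMax X
  Expands⇒HasMax {X = X} ex refl = maxAp≡X , cong (λ m → + m - + s n k 0) maxAp≡X
    where
    greatest₁ = proj₁ (Expands⇒ n k (proj₂ (expansion n k)))
    greatest₂ = proj₁ (Expands⇒ n k ex)
    maxAp≡X : maxAp ≡ X
    maxAp≡X = ≤-antisym (proj₂ greatest₂ (proj₁ greatest₁)) (proj₂ greatest₁ (proj₁ greatest₂))

theorem5p1 : ∀ (n k : ℕ) .{{_ : NonZero k}} →
    ∃₂ λ (M : ℕ) (F : ℤ) →
    Greatest _≤_ (Ap (GT n k) (s n k 0)) M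
    × IsFrobeniusNumber (GT n k) F
    × F ≡ + M - + s n k 0
    × (n ≡ 0 →
    M ≡ s n k 1
    × F ≡ + s n k 1 - + 2)
    × (n ≢ 0 → k ≡ 1 →
    M ≡ s n k n + s n k (n + 1)
    × F ≡ + (s n k n + s n k (n + 1)) - + s n k 0)
    × (2 ≤ k → k < n →
    (∃ λ t → t ∈ Coeffs-k<n n k)
    × (∀ t → t ∈ Coeffs-k<n n k →
    M ≡ weightedSum t (s n k) + s n k (n ∸ 1) + s n k (n + k)
    × F ≡ + (weightedSum t (s n k) + s n k (n ∸ 1) + s n k (n + k)) - + s n k 0))
    × (n ≡ k → 1 ≤ k →
    M ≡ s n k 1 + s n k (2 * n)
    × F ≡ + (s n k 1 + s n k (2 * n)) - + s n k 0)
    × (n ≢ 0 → k > n → k ≢ 2 →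
    (∃ λ t → t ∈ Coeffs-k>n n k)
    × (∀ t → t ∈ Coeffs-k>n n k →
    M ≡ weightedSum t (s n k) + (∑[ i < n ] s n k (k + toℕ i))
    × F ≡ + (weightedSum t (s n k) + (∑[ i < n ] s n k (k + toℕ i))) - + s n k 0))
    × (n ≡ 1 → k ≡ 2 →
    M ≡ 74
    × F ≡ + 67)
theorem5p1 n k =
  maxAp n k , + maxAp n k - + s n k 0 , proj₁ answer , proj₂ answer , refl
  , (λ { refl → case-n≡0 k })
  , (λ { n≢0 refl → case-k≡1 n n≢0 })
  , case-2≤k<n n k
  , (λ { refl _ → case-n≡k n })
  , case-k>n n k
  -- Here s₀ = 7, and 6 = 2 (2² - 1) has the digits 0, 2, so the maximum is 2 s₂ = 2 · 37.
  , λ { refl refl → Expands⇒HasMax 1 2 {0₃ ∷ 2₃ ∷ []} (0∷ lead 2₃ [] , refl) refl }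
  where
  answer = Expands⇒ n k (proj₂ (expansion n k))

  case-n≡0 : ∀ k .{{_ : NonZero k}} → maxAp 0 k ≡ s 0 k 1 × + maxAp 0 k - + s 0 k 0 ≡ + s 0 k 1 - + 2
  case-n≡0 k =
    let M≡ , F≡ = Expands⇒HasMax 0 k (Expands-n≡0 k) (one (s 0 k 1))
    in M≡ , trans F≡ (cong (λ m → + s 0 k 1 - + m) (s₀≡2 k))
    where
    one : ∀ a → 1 * a + 0 ≡ a
    one = solve-∀

  case-k≡1 : ∀ n → n ≢ 0 → HasMax n 1 (s n 1 n + s n 1 (n + 1))
  case-k≡1 zero    n≢0 = contradiction refl n≢0
  case-k≡1 (suc m) _   = Expands⇒HasMax (suc m) 1 (Expands-k≡1 m) (wsum-zeros++11 (s (suc m) 1) m)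

  case-2≤k<n : ∀ n k .{{_ : NonZero k}} → 2 ≤ k → k < n →
    (∃ λ t → t ∈ Coeffs-k<n n k)
    × (∀ t → t ∈ Coeffs-k<n n k → HasMax n k (weightedSum t (s n k) + s n k (n ∸ 1) + s n k (n + k)))
  case-2≤k<n (suc zero)    k 2≤k k<n = contradiction (≤-trans 2≤k (≤-pred k<n)) λ ()
  case-2≤k<n (suc (suc m)) k 2≤k k<n = ∃Coeffs-k<n m k 2≤k k<n ,
    λ t t∈ → Expands⇒HasMax (suc (suc m)) k (Coeffs-k<n⇒Expands m k 2≤k k<n {t} t∈) (wsum-1zeros1 (s (suc (suc m)) k) t k)

  case-n≡k : ∀ n .{{_ : NonZero n}} → HasMax n n (s n n 1 + s n n (2 * n))
  case-n≡k n@(suc m) = Expands⇒HasMax n n (Expands-n≡k m)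
    (cong₂ _+_ (*-identityˡ _) (trans (wsum-zeros++1 (s n n ∘ suc) (m + m)) (cong (s n n) (lem m))))
    where
    lem : ∀ m → suc (suc (m + m)) ≡ 2 * suc m
    lem = solve-∀

  case-k>n : ∀ n k .{{_ : NonZero k}} → n ≢ 0 → k > n → k ≢ 2 →
    (∃ λ t → t ∈ Coeffs-k>n n k)
    × (∀ t → t ∈ Coeffs-k>n n k → HasMax n k (weightedSum t (s n k) + (∑[ i < n ] s n k (k + toℕ i))))
  case-k>n n (suc k) n≢0 k>n k≢2 = ∃Coeffs-k>n n k n≢0 k>n k≢2 ,
    λ t t∈ → Expands⇒HasMax n (suc k) (Coeffs-k>n⇒Expands n k n≢0 k>n {t} t∈) (wsum-ones-suffix (s n (suc k)) t n)
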